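{- Let $G$ and $H$ be graphs such that: (a) $G$ admits an automorphism $\eta$ with $\eta(v)\in N(v)$ for every $v\in V(G)$, and every orbit of $\eta$ has even length; (b) $H$ is bipartite and every vertex of $H$ has even degree. Then $\alpha_{\mathrm{od}}(\mu[G,H])\ge |H|\cdot\alpha_{\mathrm{od}}(G)$.
   Context: For graphs $G$ and $H$, $\mu[G,H]$ is the graph obtained by replacing each vertex $w\in V(H)$ with a copy $G_w$ of $G$ and, for every edge $w_1w_2\in E(H)$, adding the perfect matching between $G_{w_1}$ and $G_{w_2}$ that joins the two copies of each vertex of $G$ (i.e., $\mu[G,H]$ is the Cartesian product $G\,\Box\,H$). An odd independent set in a graph $F=(V,E)$ is an independent set $S$ such that every $v\in V\setminus S$ has either no neighbor or an odd number of neighbors in $S$; $\alpha_{\mathrm{od}}(F)$ is the maximum size of such a set. $|H|$ is the number of vertices of $H$; $N(v)$ is the open neighborhood. -}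

module Defs where

open import Level using (0ℓ)
open import Data.Nat using (ℕ; zero; suc; _*_; _≤_)
import Data.Nat as ℕ
open import Data.Nat.Divisibility using (_∣_; _∤_; _∣?_)
open import Data.Fin using (Fin; quotient; remainder; _≟_)
open import Data.Fin.Properties using (all?)
open import Data.Fin.Permutation using (Permutation′; _⟨$⟩ʳ_)
open import Data.Fin.Subset using (Subset; inside; outside; _∈_; _∉_; _∩_; ∁; ⊥; ∣_∣)
open import Data.Fin.Subset.Properties using (_∈?_; ∉⊥; ∣⊥∣≡0; ∩-zeroʳ)
open import Data.List using (List; []; _∷_; _++_; map; filter)
open import Data.List.Extrema.Nat using (max; xs≤max; argmax-sel)
import Data.List.Membership.Propositional as List
open import Data.List.Membership.Propositional.Properties using (∈-map⁺; ∈-map⁻; ∈-++⁺ˡ; ∈-++⁺ʳ; ∈-filter⁺; ∈-filter⁻)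
open import Data.List.Relation.Unary.Any using (here)
import Data.List.Relation.Unary.All as All
open import Data.Product using (_×_; _,_; ∃-syntax; proj₂)
open import Data.Sum using (_⊎_; inj₁; inj₂)
import Data.Sum as Sum
import Data.Product as Product
open import Data.Vec using ([]; _∷_; tabulate)
open import Function using (id; _⇔_)
import Function.Endo.Propositional as Endo
open import Relation.Binary using (Rel; Decidable; Symmetric; Irreflexive)
open import Relation.Binary.PropositionalEquality using (_≡_; refl; sym; trans; cong)
open import Relation.Nullary using (Dec; ¬_; ¬?; does; _×-dec_; _⊎-dec_; _→-dec_)

-- Finite simple graphs, on the vertex set Fin order.
record Graph : Set₁ where
  infix 4 _~_ _~?_
  field
    order  : ℕ
    _~_    : Rel (Fin order) 0ℓ
    _~?_   : Decidable _~_
    ~-sym  : Symmetric _~_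
    ~-irr  : Irreflexive _≡_ _~_

  Vertex : Set
  Vertex = Fin order

  N : Vertex → Subset order
  N v = tabulate (λ w → does (v ~? w))

  degree : Vertex → ℕ
  degree v = ∣ N v ∣

  IsIndependent : Subset order → Set
  IsIndependent S = ∀ u v → u ∈ S → v ∈ S → ¬ (u ~ v)

  IsOddIndependent : Subset order → Set
  IsOddIndependent S =
    IsIndependent S ×
    (∀ v → v ∉ S → (∣ N v ∩ S ∣ ≡ 0) ⊎ (2 ∤ ∣ N v ∩ S ∣))

  isOddIndependent? : ∀ S → Dec (IsOddIndependent S)
  isOddIndependent? S =
    all? (λ u → all? (λ v → (u ∈? S) →-dec ((v ∈? S) →-dec ¬? (u ~? v))))
    ×-dec
    all? (λ v → ¬? (v ∈? S) →-dec
                ((∣ N v ∩ S ∣ ℕ.≟ 0) ⊎-dec ¬? (2 ∣? ∣ N v ∩ S ∣)))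

  IsBipartite : Set
  IsBipartite = ∃[ A ] (IsIndependent A × IsIndependent (∁ A))

  IsAutomorphism : Permutation′ order → Set
  IsAutomorphism η = ∀ u v → (u ~ v) ⇔ ((η ⟨$⟩ʳ u) ~ (η ⟨$⟩ʳ v))

-- O = { ηᵏ(v) : k ∈ ℕ } for some v; the set being finite, the negative
-- powers of η contribute no further points.
IsOrbit : ∀ {n} → Permutation′ n → Subset n → Set
IsOrbit {n} η O = ∃[ v ] (∀ w → (w ∈ O) ⇔ (∃[ k ] ((η ⟨$⟩ʳ_) ^ k) v ≡ w))
  where open Endo (Fin n) using (_^_)

subsets : ∀ n → List (Subset n)
subsets zero    = [] ∷ []
subsets (suc n) = map (inside ∷_) (subsets n) ++ map (outside ∷_) (subsets n)

-- The default value 0 does not affect the maximum: the empty set is an odd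
-- independent set (see αod-attained).
αod : Graph → ℕ
αod F = max 0 (map ∣_∣ (filter isOddIndependent? (subsets order)))
  where open Graph F

-- A vertex x of μ[ G , H ] is the copy of the vertex  base x  of G lying in
-- the copy of G that replaces the vertex  copy x  of H.
μ[_,_] : Graph → Graph → Graph
μ[ G , H ] = record
  { order = H.order * G.order
  ; _~_   = λ x y → (copy x ≡ copy y × base x G.~ base y)
                  ⊎ (base x ≡ base y × copy x H.~ copy y)
  ; _~?_  = λ x y → ((copy x ≟ copy y) ×-dec (base x G.~? base y))
             ⊎-dec ((base x ≟ base y) ×-dec (copy x H.~? copy y))
  ; ~-sym = Sum.map (Product.map sym G.~-sym) (Product.map sym H.~-sym)
  ; ~-irr = λ { refl (inj₁ (_ , e)) → G.~-irr refl e
              ; refl (inj₂ (_ , e)) → H.~-irr refl e }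
  }
  where
  module G = Graph G
  module H = Graph H

  copy : Fin (H.order * G.order) → H.Vertex
  copy = quotient G.order

  base : Fin (H.order * G.order) → G.Vertex
  base = remainder {H.order} G.order

∈-subsets : ∀ {n} (S : Subset n) → S List.∈ subsets n
∈-subsets []            = here refl
∈-subsets (inside  ∷ S) = ∈-++⁺ˡ (∈-map⁺ (inside ∷_) (∈-subsets S))
∈-subsets (outside ∷ S) =
  ∈-++⁺ʳ (map (inside ∷_) (subsets _)) (∈-map⁺ (outside ∷_) (∈-subsets S))

module _ (F : Graph) where
  open Graph F

  αod-upper : ∀ S → IsOddIndependent S → ∣ S ∣ ≤ αod F
  αod-upper S odd = All.lookup
    (xs≤max 0 (map ∣_∣ (filter isOddIndependent? (subsets order))))
    (∈-map⁺ ∣_∣ (∈-filter⁺ isOddIndependent? (∈-subsets S) odd))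

  ⊥-oddIndependent : IsOddIndependent ⊥
  ⊥-oddIndependent =
    (λ u v u∈⊥ _ _ → ∉⊥ u∈⊥) ,
    (λ v _ → inj₁ (trans (cong ∣_∣ (∩-zeroʳ (N v))) (∣⊥∣≡0 order)))

  αod-attained : ∃[ S ] (IsOddIndependent S × ∣ S ∣ ≡ αod F)
  αod-attained
    with argmax-sel id 0 (map ∣_∣ (filter isOddIndependent? (subsets order)))
  ... | inj₁ α≡0 = ⊥ , ⊥-oddIndependent , trans (∣⊥∣≡0 order) (sym α≡0)
  ... | inj₂ α∈  with ∈-map⁻ ∣_∣ α∈
  ...   | S , S∈ , α≡∣S∣ =
    S , proj₂ (∈-filter⁻ isOddIndependent? {xs = subsets order} S∈) , sym α≡∣S∣

{-# OPTIONS --safe #-}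
-- Let S be a maximum odd independent set of G and T = η⁻¹(S), which is again
-- odd independent of the same size.  Put S into the copies of G over one side
-- of the bipartition of H and T into the copies over the other side.  Every
-- vertex of T has a neighbour in S (its image under η), and vice versa, so
-- S and T are disjoint and the union of all copies is independent.  A vertex
-- (v , w) outside the union has, besides its neighbours in its own copy, either
-- no neighbours or exactly deg w many, and the latter happens only if v lies in
-- the set used on the opposite side; then v has a neighbour in its own copy,
-- hence an odd number of them, and adding the even number deg w keeps it odd.
module Submission where

open import Defs
open import Data.Bool using (Bool; true; false; not; _∧_; _∨_; if_then_else_)
open import Data.Fin using (Fin; zero; suc; _↑ˡ_; _↑ʳ_; combine; quotient; remainder; _≟_)
open import Data.Fin.Permutation using (Permutation′; _⟨$⟩ʳ_; _⟨$⟩ˡ_; inverseʳ)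
open import Data.Fin.Properties using (remQuot-combine)
open import Data.Fin.Subset using (Subset; _∈_; _∉_; _∩_; ∣_∣; ∁)
open import Data.Fin.Subset.Properties using (x∈p⇒∣p-x∣<∣p∣; x∈p∩q⁺; x∉p⇒x∈∁p)
open import Data.Nat using (ℕ; zero; suc; _+_; _*_; _≤_; _≥_)
open import Data.Nat.Divisibility using (_∣_; _∤_; ∣m+n∣m⇒∣n; ∣m⇒∣m*n)
open import Data.Nat.Properties using (+-assoc; +-comm; +-identityʳ; *-zeroʳ; +-*-semiring; m<n⇒n≢0)
open import Data.Product using (_×_; _,_; Σ-syntax; ∃-syntax; proj₁; proj₂)
open import Data.Sum using (_⊎_; inj₁; inj₂)
open import Data.Vec using ([]; _∷_; lookup; tabulate)
open import Data.Vec.Properties using ([]=⇒lookup; lookup⇒[]=; lookup-zipWith; lookup∘tabulate)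
open import Function using (_∘_; Equivalence)
open import Relation.Binary.PropositionalEquality using (_≡_; _≢_; refl; sym; trans; cong; cong₂; subst; module ≡-Reasoning)
open import Relation.Nullary using (Dec; yes; no; ¬_; does; contradiction)
open import Relation.Nullary.Decidable using (dec-true; does-⇔)

open import Algebra.Properties.Semiring.Sum +-*-semiring
  using (sum; sum-cong-≗; sum-syntax; sum-replicate-zero; sum-permute; ∑-distrib-+; *-distribʳ-sum; *-distribˡ-sum)
open ≡-Reasoning

-- Indicators of Boolean conditions

𝟙 : Bool → ℕ
𝟙 b = if b then 1 else 0

-- The Boolean on the left has the shape of adjacency in `μ[ G , H ]` intersected with a set: `a?`
-- is equality of copies, `c` equality of bases. Exclusive alternatives add without overlap, and
-- each summand keeps an equality test as a factor, ready for `sum-δ`.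
𝟙-exclusive-∨ : ∀ {A D : Set} (a? : Dec A) (d? : Dec D) → (A → ¬ D) → ∀ b c f →
  𝟙 (((does a? ∧ b) ∨ (c ∧ does d?)) ∧ f)
    ≡ 𝟙 (does a?) * 𝟙 (b ∧ f) + 𝟙 c * 𝟙 (does d? ∧ f)
𝟙-exclusive-∨ (yes a) (yes d) a⇒¬d b     c     f     = contradiction d (a⇒¬d a)
𝟙-exclusive-∨ (yes a) (no ¬d) a⇒¬d true  true  true  = refl
𝟙-exclusive-∨ (yes a) (no ¬d) a⇒¬d true  true  false = refl
𝟙-exclusive-∨ (yes a) (no ¬d) a⇒¬d true  false true  = refl
𝟙-exclusive-∨ (yes a) (no ¬d) a⇒¬d true  false false = refl
𝟙-exclusive-∨ (yes a) (no ¬d) a⇒¬d false true  f     = refl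
𝟙-exclusive-∨ (yes a) (no ¬d) a⇒¬d false false f     = refl
𝟙-exclusive-∨ (no ¬a) d?      a⇒¬d b     false f     = refl
𝟙-exclusive-∨ (no ¬a) d?      a⇒¬d b     true  f     = sym (+-identityʳ _)

-- Finite sums and cardinalities

∣p∣≡sum : ∀ {n} (p : Subset n) → ∣ p ∣ ≡ sum (𝟙 ∘ lookup p)
∣p∣≡sum []          = refl
∣p∣≡sum (true  ∷ p) = cong suc (∣p∣≡sum p)
∣p∣≡sum (false ∷ p) = ∣p∣≡sum p

∣tabulate∣≡sum : ∀ {n} (f : Fin n → Bool) → ∣ tabulate f ∣ ≡ sum (𝟙 ∘ f)
∣tabulate∣≡sum f = trans (∣p∣≡sum (tabulate f)) (sum-cong-≗ (cong 𝟙 ∘ lookup∘tabulate f))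

∣tabulate∩∣≡sum : ∀ {n} (f : Fin n → Bool) (p : Subset n) →
                  ∣ tabulate f ∩ p ∣ ≡ ∑[ i < n ] 𝟙 (f i ∧ lookup p i)
∣tabulate∩∣≡sum f p = trans (∣p∣≡sum (tabulate f ∩ p)) (sum-cong-≗ λ i → cong 𝟙
  (trans (lookup-zipWith _∧_ i (tabulate f) p)
         (cong (_∧ lookup p i) (lookup∘tabulate f i))))

x∈p⇒∣p∣≢0 : ∀ {n} {x : Fin n} {p : Subset n} → x ∈ p → ∣ p ∣ ≢ 0
x∈p⇒∣p∣≢0 x∈p = m<n⇒n≢0 (x∈p⇒∣p-x∣<∣p∣ x∈p)

sum-const : ∀ n c → ∑[ i < n ] c ≡ n * c
sum-const zero    c = refl
sum-const (suc n) c = cong (c +_) (sum-const n c)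

sum-↑ : ∀ m {n} (f : Fin (m + n) → ℕ) →
        sum f ≡ sum (f ∘ (_↑ˡ n)) + sum (f ∘ (m ↑ʳ_))
sum-↑ zero    f = refl
sum-↑ (suc m) f = trans (cong (f zero +_) (sum-↑ m (f ∘ suc))) (sym (+-assoc (f zero) _ _))

sum-combine : ∀ m n (f : Fin (m * n) → ℕ) →
              sum f ≡ ∑[ i < m ] ∑[ j < n ] f (combine i j)
sum-combine zero    n f = refl
sum-combine (suc m) n f = trans (sum-↑ n f)
  (cong (sum (f ∘ (_↑ˡ (m * n))) +_) (sum-combine m n (f ∘ (n ↑ʳ_))))

sum-quotient-remainder : ∀ m n (f : Fin m → Fin n → ℕ) →
  ∑[ x < m * n ] f (quotient n x) (remainder {m} n x) ≡ ∑[ i < m ] ∑[ j < n ] f i j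
sum-quotient-remainder m n f = trans (sum-combine m n _) (sum-cong-≗ λ i → sum-cong-≗ λ j →
  cong (λ q → f (proj₁ q) (proj₂ q)) (remQuot-combine {m} {n} i j))

sum-δ : ∀ {n} (k : Fin n) (f : Fin n → ℕ) →
        ∑[ i < n ] (𝟙 (does (k ≟ i)) * f i) ≡ f k
sum-δ {suc n} zero    f = trans (cong₂ _+_ (+-identityʳ (f zero)) (sum-replicate-zero n)) (+-identityʳ (f zero))
sum-δ {suc n} (suc k) f = sum-δ k (f ∘ suc)

-- Neighbourhoods as subsets

module _ (F : Graph) where
  open Graph F

  ∈N⇒~ : ∀ {v u} → u ∈ N v → v ~ u
  ∈N⇒~ {v} {u} u∈ with v ~? u | trans (sym (lookup∘tabulate (λ w → does (v ~? w)) u)) ([]=⇒lookup u∈)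
  ... | yes v~u | _ = v~u

  ~⇒∈N : ∀ {v u} → v ~ u → u ∈ N v
  ~⇒∈N {v} {u} v~u = lookup⇒[]= u (N v)
    (trans (lookup∘tabulate (λ w → does (v ~? w)) u) (dec-true (v ~? u) v~u))

-- Sets in μ[ G , H ] assembled from one set per copy of G

module _ (G H : Graph) where
  private
    module G = Graph G
    module H = Graph H
    module M = Graph μ[ G , H ]

  copy : M.Vertex → H.Vertex
  copy = quotient G.order

  base : M.Vertex → G.Vertex
  base = remainder {H.order} G.order

  union : (H.Vertex → Subset G.order) → Subset M.order
  union F = tabulate λ x → lookup (F (copy x)) (base x)

  ∈-union⁻ : ∀ F {x} → x ∈ union F → base x ∈ F (copy x)
  ∈-union⁻ F {x} x∈ = lookup⇒[]= (base x) (F (copy x))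
    (trans (sym (lookup∘tabulate _ x)) ([]=⇒lookup x∈))

  ∈-union⁺ : ∀ F {x} → base x ∈ F (copy x) → x ∈ union F
  ∈-union⁺ F {x} b∈ = lookup⇒[]= x (union F)
    (trans (lookup∘tabulate _ x) ([]=⇒lookup b∈))

  ∣union∣ : ∀ F → ∣ union F ∣ ≡ ∑[ w < H.order ] ∣ F w ∣
  ∣union∣ F = begin
    ∣ union F ∣
      ≡⟨ ∣tabulate∣≡sum (λ x → lookup (F (copy x)) (base x)) ⟩
    ∑[ x < H.order * G.order ] 𝟙 (lookup (F (copy x)) (base x))
      ≡⟨ sum-quotient-remainder H.order G.order (λ i j → 𝟙 (lookup (F i) j)) ⟩
    ∑[ i < H.order ] ∑[ j < G.order ] 𝟙 (lookup (F i) j)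
      ≡⟨ sum-cong-≗ (λ i → sym (∣p∣≡sum (F i))) ⟩
    ∑[ i < H.order ] ∣ F i ∣ ∎

  -- A neighbour of `x` either lies in the same copy of `G`, or is the single vertex with the same
  -- base in a copy adjacent to that of `x`. No vertex is of both kinds, as `H` has no loops.
  ∣N∩union∣ : ∀ F x → ∣ M.N x ∩ union F ∣ ≡
    ∣ G.N (base x) ∩ F (copy x) ∣
      + ∑[ i < H.order ] 𝟙 (does (copy x H.~? i) ∧ lookup (F i) (base x))
  ∣N∩union∣ F x = begin
    ∣ M.N x ∩ union F ∣
      ≡⟨ ∣tabulate∩∣≡sum _ (union F) ⟩
    ∑[ y < M.order ] 𝟙 (does (x M.~? y) ∧ lookup (union F) y)
      ≡⟨ sum-cong-≗ (λ y → trans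
           (cong (λ z → 𝟙 (does (x M.~? y) ∧ z)) (lookup∘tabulate _ y))
           (𝟙-exclusive-∨ (w ≟ copy y) (w H.~? copy y) H.~-irr _ _ _)) ⟩
    ∑[ y < M.order ] (inner (copy y) (base y) + cross (copy y) (base y))
      ≡⟨ sum-quotient-remainder H.order G.order (λ i j → inner i j + cross i j) ⟩
    ∑[ i < H.order ] ∑[ j < G.order ] (inner i j + cross i j)
      -- In `inner` the test `w ≟ i` does not depend on `j` and factors out; in `cross` the test
      -- `v ≟ j` leaves only the term `j = v`.
      ≡⟨ sum-cong-≗ (λ i → trans (∑-distrib-+ (inner i) (cross i)) (cong₂ _+_
           (sym (*-distribˡ-sum (𝟙 (does (w ≟ i))) (λ j → 𝟙 (does (v G.~? j) ∧ lookup (F i) j))))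
           (sum-δ v (λ j → 𝟙 (does (w H.~? i) ∧ lookup (F i) j))))) ⟩
    ∑[ i < H.order ] (𝟙 (does (w ≟ i)) * within i + across i)
      ≡⟨ ∑-distrib-+ (λ i → 𝟙 (does (w ≟ i)) * within i) across ⟩
    ∑[ i < H.order ] (𝟙 (does (w ≟ i)) * within i) + sum across
      ≡⟨ cong (_+ sum across) (sum-δ w within) ⟩
    within w + sum across
      ≡⟨ cong (_+ sum across) (sym (∣tabulate∩∣≡sum _ (F w))) ⟩
    ∣ G.N v ∩ F w ∣ + sum across ∎
    where
    v = base x
    w = copy x
    inner cross : H.Vertex → G.Vertex → ℕ
    inner i j = 𝟙 (does (w ≟ i)) * 𝟙 (does (v G.~? j) ∧ lookup (F i) j)
    cross i j = 𝟙 (does (v ≟ j)) * 𝟙 (does (w H.~? i) ∧ lookup (F i) j)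
    within across : H.Vertex → ℕ
    within i = ∑[ j < G.order ] 𝟙 (does (v G.~? j) ∧ lookup (F i) j)
    across i = 𝟙 (does (w H.~? i) ∧ lookup (F i) v)

  module _ (side : H.Vertex → Bool) (proper : ∀ {i j} → i H.~ j → side j ≡ not (side i))
           (even : ∀ w → 2 ∣ H.degree w)
           (P : Bool → Subset G.order) (odd : ∀ b → G.IsOddIndependent (P b))
           (neighbour : ∀ b {v} → v ∈ P (not b) → ∃[ u ] (u ∈ P b × v G.~ u)) where

    -- All neighbours of `w` lie on the side opposite to `w` and so carry the same set; each
    -- contributes the same indicator `c`.
    ∑-cross : ∀ w v →
      ∑[ i < H.order ] 𝟙 (does (w H.~? i) ∧ lookup (P (side i)) v)
        ≡ H.degree w * 𝟙 (lookup (P (not (side w))) v)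
    ∑-cross w v = begin
      ∑[ i < H.order ] 𝟙 (does (w H.~? i) ∧ lookup (P (side i)) v)
        ≡⟨ sum-cong-≗ opposite ⟩
      ∑[ i < H.order ] (𝟙 (does (w H.~? i)) * c)
        ≡⟨ sym (*-distribʳ-sum c (λ i → 𝟙 (does (w H.~? i)))) ⟩
      sum (λ i → 𝟙 (does (w H.~? i))) * c
        ≡⟨ cong (_* c) (sym (∣tabulate∣≡sum (λ i → does (w H.~? i)))) ⟩
      H.degree w * c ∎
      where
      c = 𝟙 (lookup (P (not (side w))) v)
      opposite : ∀ i → 𝟙 (does (w H.~? i) ∧ lookup (P (side i)) v) ≡ 𝟙 (does (w H.~? i)) * c
      opposite i with w H.~? i
      ... | yes w~i = trans (cong (λ b → 𝟙 (lookup (P b) v)) (proper w~i)) (sym (+-identityʳ c))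
      ... | no  _   = refl

    union-oddIndependent : M.IsOddIndependent (union (P ∘ side))
    union-oddIndependent = independent , parity
      where
      F = P ∘ side

      independent : M.IsIndependent (union F)
      independent x y x∈ y∈ (inj₁ (same , e)) =
        proj₁ (odd (side (copy y))) (base x) (base y)
          (subst (λ w → base x ∈ F w) same (∈-union⁻ F x∈)) (∈-union⁻ F y∈) e
      -- The common base would lie in the sets of both sides. By `neighbour` it is then adjacent to
      -- some `u` in the set over `copy x`, which also contains it, against independence of that
      -- set.
      independent x y x∈ y∈ (inj₂ (same , e))
        with neighbour (side (copy x)) {base y} (subst (λ b → base y ∈ P b) (proper e) (∈-union⁻ F y∈))
      ... | u , u∈ , y~u = proj₁ (odd (side (copy x))) (base y) u
        (subst (_∈ F (copy x)) same (∈-union⁻ F x∈)) u∈ y~u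

      parity : ∀ x → x ∉ union F → (∣ M.N x ∩ union F ∣ ≡ 0) ⊎ (2 ∤ ∣ M.N x ∩ union F ∣)
      parity x x∉
        rewrite ∣N∩union∣ F x | ∑-cross (copy x) (base x)
        with lookup (P (not (side (copy x)))) (base x) in eq
           | proj₂ (odd (side (copy x))) (base x) (x∉ ∘ ∈-union⁺ F)
      -- The matching edges contribute zero, so the condition is the one already known inside the
      -- copy.
      ... | false | own rewrite *-zeroʳ (H.degree (copy x))
                              | +-identityʳ ∣ G.N (base x) ∩ F (copy x) ∣ = own
      -- The matching edges contribute `H.degree (copy x) * 1`, an even number. If the total were
      -- even, cancelling this summand would make the count inside the copy even.
      ... | true  | inj₂ own-odd = inj₂ λ 2∣ → own-odd (∣m+n∣m⇒∣n
              (subst (2 ∣_) (+-comm ∣ G.N (base x) ∩ F (copy x) ∣ _) 2∣)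
              (∣m⇒∣m*n 1 (even (copy x))))
      -- The base lies in the opposite set, so `neighbour` supplies a neighbour in its own copy and
      -- the count there cannot vanish.
      ... | true  | inj₁ own≡0
        with neighbour (side (copy x)) (lookup⇒[]= (base x) _ eq)
      ...   | u , u∈ , v~u = contradiction own≡0 (x∈p⇒∣p∣≢0 (x∈p∩q⁺ (~⇒∈N G v~u , u∈)))

-- Preimages under automorphisms

preimage : ∀ {n} → Permutation′ n → Subset n → Subset n
preimage η p = tabulate λ v → lookup p (η ⟨$⟩ʳ v)

module _ {n} (η : Permutation′ n) (p : Subset n) where

  ∈-preimage⁻ : ∀ {v} → v ∈ preimage η p → (η ⟨$⟩ʳ v) ∈ p
  ∈-preimage⁻ {v} v∈ = lookup⇒[]= _ p (trans (sym (lookup∘tabulate _ v)) ([]=⇒lookup v∈))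

  ∈-preimage⁺ : ∀ {v} → (η ⟨$⟩ʳ v) ∈ p → v ∈ preimage η p
  ∈-preimage⁺ {v} ηv∈ = lookup⇒[]= v _ (trans (lookup∘tabulate _ v) ([]=⇒lookup ηv∈))

  ∣preimage∣ : ∣ preimage η p ∣ ≡ ∣ p ∣
  ∣preimage∣ = begin
    ∣ preimage η p ∣                        ≡⟨ ∣tabulate∣≡sum (λ v → lookup p (η ⟨$⟩ʳ v)) ⟩
    sum (λ v → 𝟙 (lookup p (η ⟨$⟩ʳ v)))  ≡⟨ sum-permute (𝟙 ∘ lookup p) η ⟨
    sum (𝟙 ∘ lookup p)                     ≡⟨ ∣p∣≡sum p ⟨
    ∣ p ∣                                   ∎

module _ (G : Graph) (η : Permutation′ (Graph.order G)) (aut : Graph.IsAutomorphism G η) where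
  open Graph G

  -- An automorphism carries `N v` bijectively onto the neighbourhood of the image of `v`, and
  -- `preimage η S` onto `S`; the sum is reindexed along `η`.
  ∣N∩preimage∣ : ∀ S v → ∣ N v ∩ preimage η S ∣ ≡ ∣ N (η ⟨$⟩ʳ v) ∩ S ∣
  ∣N∩preimage∣ S v = begin
    ∣ N v ∩ preimage η S ∣
      ≡⟨ ∣tabulate∩∣≡sum _ (preimage η S) ⟩
    ∑[ u < order ] 𝟙 (does (v ~? u) ∧ lookup (preimage η S) u)
      ≡⟨ sum-cong-≗ (λ u → cong 𝟙 (cong₂ _∧_
           (does-⇔ (aut v u) (v ~? u) ((η ⟨$⟩ʳ v) ~? (η ⟨$⟩ʳ u)))
           (lookup∘tabulate _ u))) ⟩
    ∑[ u < order ] 𝟙 (does ((η ⟨$⟩ʳ v) ~? (η ⟨$⟩ʳ u)) ∧ lookup S (η ⟨$⟩ʳ u))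
      ≡⟨ sum-permute (λ u → 𝟙 (does ((η ⟨$⟩ʳ v) ~? u) ∧ lookup S u)) η ⟨
    ∑[ u < order ] 𝟙 (does ((η ⟨$⟩ʳ v) ~? u) ∧ lookup S u)
      ≡⟨ ∣tabulate∩∣≡sum _ S ⟨
    ∣ N (η ⟨$⟩ʳ v) ∩ S ∣ ∎

  preimage-oddIndependent : ∀ {S} → IsOddIndependent S → IsOddIndependent (preimage η S)
  preimage-oddIndependent {S} (ind , par) =
    (λ u v u∈ v∈ u~v → ind _ _ (∈-preimage⁻ η S u∈) (∈-preimage⁻ η S v∈)
                              (Equivalence.to (aut u v) u~v)) ,
    (λ v v∉ → subst (λ k → (k ≡ 0) ⊎ (2 ∤ k)) (sym (∣N∩preimage∣ S v))
                    (par (η ⟨$⟩ʳ v) (v∉ ∘ ∈-preimage⁺ η S)))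

-- Bipartitions and the choice of the two sets

bipartition-proper : (H : Graph) (let open Graph H) {A : Subset order} →
  IsIndependent A → IsIndependent (∁ A) →
  ∀ {i j} → i ~ j → lookup A j ≡ not (lookup A i)
bipartition-proper H {A} ind ind∁ {i} {j} i~j with lookup A i in eqi | lookup A j in eqj
-- Equal values would put both ends of an edge into `A` or both into `∁ A`, and each class is
-- independent.
... | true  | true  = contradiction i~j (ind i j (lookup⇒[]= i A eqi) (lookup⇒[]= j A eqj))
... | true  | false = refl
... | false | true  = refl
... | false | false = contradiction i~j (ind∁ i j (outside⇒∈∁ eqi) (outside⇒∈∁ eqj))
  where
  outside⇒∈∁ : ∀ {k} → lookup A k ≡ false → k ∈ ∁ A
  outside⇒∈∁ eq = x∉p⇒x∈∁p λ k∈A → contradiction (trans (sym eq) ([]=⇒lookup k∈A)) λ ()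

theorem3 : (G H : Graph) →
    (Σ[ η ∈ Permutation′ (Graph.order G) ] (Graph.IsAutomorphism G η × (∀ v → (η ⟨$⟩ʳ v) ∈ Graph.N G v) × (∀ O → IsOrbit η O → 2 ∣ ∣ O ∣))) →
    (Graph.IsBipartite H × (∀ w → 2 ∣ Graph.degree H w)) →
    αod μ[ G , H ] ≥ Graph.order H * αod G
theorem3 G H (η , aut , moves , _) ((A , ind , ind∁) , even) with αod-attained G
... | S , S-odd , ∣S∣≡α = subst (_≤ αod μ[ G , H ]) size (αod-upper μ[ G , H ] (union G H F)
        (union-oddIndependent G H (lookup A) (bipartition-proper H ind ind∁) even P odd neighbour))
  where
  open Graph G

  P : Bool → Subset order
  P true  = S
  P false = preimage η S

  F : Graph.Vertex H → Subset order
  F w = P (lookup A w)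

  odd : ∀ b → IsOddIndependent (P b)
  odd true  = S-odd
  odd false = preimage-oddIndependent G η aut S-odd

  v~ηv : ∀ v → v ~ (η ⟨$⟩ʳ v)
  v~ηv v = ∈N⇒~ G (moves v)

  neighbour : ∀ b {v} → v ∈ P (not b) → ∃[ u ] (u ∈ P b × v ~ u)
  neighbour true  {v} v∈ = η ⟨$⟩ʳ v , ∈-preimage⁻ η S v∈ , v~ηv v
  -- The vertex `η ⟨$⟩ˡ v` is sent by `η` to `v`, hence lies in the preimage of `S` and, since `η`
  -- moves each vertex to a neighbour, is adjacent to `v`.
  neighbour false {v} v∈ = η ⟨$⟩ˡ v ,
    ∈-preimage⁺ η S (subst (_∈ S) (sym (inverseʳ η)) v∈) ,
    ~-sym (subst ((η ⟨$⟩ˡ v) ~_) (inverseʳ η) (v~ηv (η ⟨$⟩ˡ v)))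

  ∣P∣ : ∀ b → ∣ P b ∣ ≡ αod G
  ∣P∣ true  = ∣S∣≡α
  ∣P∣ false = trans (∣preimage∣ η S) ∣S∣≡α

  size : ∣ union G H F ∣ ≡ Graph.order H * αod G
  size = trans (∣union∣ G H F)
    (trans (sum-cong-≗ (∣P∣ ∘ lookup A)) (sum-const (Graph.order H) (αod G)))
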